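{- Every (finite) tree is $7$-cordial. That is, for every finite tree $T$ there is a function $f: V(T) \to \mathbb{Z}_7$ such that, defining the weight of each edge $uv$ as $f(uv) = f(u) + f(v) \pmod 7$ and letting $v_a$ (resp. $e_a$) denote the number of vertices (resp. edges) with label (resp. weight) $a$, we have $|v_a - v_b| \le 1$ and $|e_a - e_b| \le 1$ for all $a, b \in \mathbb{Z}_7$.
   Context: All graphs are finite and simple. For an integer $k>0$, a $k$-cordial labeling of a tree $T$ is a map $f:V(T)\to\mathbb{Z}_k$, inducing edge weights $f(uv)=f(u)+f(v) \pmod k$, such that each label appears on at most one more vertex than any other label and each weight appears on at most one more edge than any other weight. A tree is $k$-cordial if it admits a $k$-cordial labeling. -}

module Defs where

open import Data.Nat using (ℕ; zero; suc; _+_; _≤_; _<_; NonZero)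
open import Data.Nat.DivMod using (_mod_)
open import Data.Fin using (Fin; toℕ; fromℕ<)
open import Data.Fin.Properties using (_≟_)
open import Data.Bool using (Bool; true; false; if_then_else_)
open import Data.List using (List; []; _∷_; length; filterᵇ; allFin; concatMap; map)
open import Data.List.Relation.Unary.Unique.Propositional using (Unique)
open import Data.Product using (_×_; _,_; Σ; ∃; proj₁; proj₂)
open import Relation.Binary.PropositionalEquality using (_≡_)
open import Relation.Nullary using (¬_)
open import Relation.Nullary.Decidable using (does)
open import Data.Nat using (_<ᵇ_)

record Graph (n : ℕ) : Set where
  field
    adj     : Fin n → Fin n → Bool
    sym     : ∀ u v → adj u v ≡ adj v u
    irrefl  : ∀ u → adj u u ≡ false
open Graph public

Adj : ∀ {n} → Graph n → Fin n → Fin n → Set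
Adj G u v = adj G u v ≡ true

data Walk {n : ℕ} (G : Graph n) : Fin n → Fin n → List (Fin n) → Set where
  here : ∀ u → Walk G u u (u ∷ [])
  step : ∀ {u v w vs} → Adj G u v → Walk G v w vs → Walk G u w (u ∷ vs)

Connected : ∀ {n} → Graph n → Set
Connected {n} G = ∀ (u v : Fin n) → ∃ λ vs → Walk G u v vs

HasCycle : ∀ {n} → Graph n → Set
HasCycle {n} G = Σ (Fin n) λ u → Σ (Fin n) λ w → Σ (List (Fin n)) λ vs →
  Walk G u w vs × Unique vs × (3 ≤ length vs) × Adj G w u

IsTree : ∀ {n} → Graph n → Set
IsTree {n} G = (1 ≤ n) × Connected G × ¬ HasCycle G

edges : ∀ {n} → Graph n → List (Fin n × Fin n)
edges {n} G = concatMap (λ u → map (λ v → u , v)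
                (filterᵇ (λ v → (toℕ u <ᵇ toℕ v) Data.Bool.∧ adj G u v) (allFin n) ))
              (allFin n)
  where open import Data.Bool using (_∧_)

_+ₖ_ : ∀ {k} → Fin (suc k) → Fin (suc k) → Fin (suc k)
_+ₖ_ {k} a b = (toℕ a + toℕ b) mod (suc k)

countᵇ : ∀ {A : Set} → (A → Bool) → List A → ℕ
countᵇ p xs = length (filterᵇ p xs)

vcount : ∀ {n k} → (Fin n → Fin (suc k)) → Fin (suc k) → ℕ
vcount {n} f a = countᵇ (λ u → does (f u ≟ a)) (allFin n)

ecount : ∀ {n k} → Graph n → (Fin n → Fin (suc k)) → Fin (suc k) → ℕ
ecount G f a = countᵇ (λ e → does ((f (proj₁ e) +ₖ f (proj₂ e)) ≟ a)) (edges G)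

Near : ℕ → ℕ → Set
Near x y = (x ≤ suc y) × (y ≤ suc x)

IsCordialLabeling : ∀ {n k} → Graph n → (Fin n → Fin (suc k)) → Set
IsCordialLabeling {n} {k} G f =
  (∀ (a b : Fin (suc k)) → Near (vcount f a) (vcount f b)) ×
  (∀ (a b : Fin (suc k)) → Near (ecount G f a) (ecount G f b))

IsCordial : ∀ {n} → (k : ℕ) → .{{NonZero k}} → Graph n → Set
IsCordial {n} (suc k) G = Σ (Fin n → Fin (suc k)) λ f → IsCordialLabeling G f

{-# OPTIONS --safe #-}
module Submission where

-- The vertices of a tree can be listed so that each one after the first is joined to exactly
-- one earlier vertex.  After 7q + 1 vertices of such a list, keep the labels balanced with one
-- surplus label and all weights equally frequent.  The next six vertices can always be labelled
-- so that no label among them and the surplus one repeats and no weight repeats, whatever their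
-- parents are; then each label is equally frequent and one weight is missing, and the label of
-- the seventh vertex is forced by giving its edge the missing weight.  That six vertices can be
-- treated is a finite check over all shapes of the added forest and all labels of its external
-- parents; an affine change of labels makes the surplus label 0 and the label of the first
-- parent 0 or 1.  A labelling of six vertices restricts to one of the first few of them.

open import Defs renaming (sym to adj-sym; here to stop)
open import Data.Bool using (Bool; true; false; T; _∧_; if_then_else_)
open import Data.Bool.ListAction using (all)
import Data.Bool.Properties as Bool
open import Data.Empty using (⊥-elim)
open import Data.Fin using (Fin; zero; suc; toℕ)
open import Data.Fin.Patterns using (0F; 1F)
open import Data.Fin.Properties using (_≟_; all?; any?; suc-injective; toℕ-injective)
open import Data.Fin.Subset using (Subset; ⊥; ⊤; ∣_∣)
open import Data.Fin.Subset.Properties using (∣p∣≡n⇒p≡⊤)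
open import Data.List using (List; []; _∷_; _++_; _∷ʳ_; map; concatMap; filterᵇ; allFin; length)
open import Data.List.Membership.DecPropositional using (_∈?_)
open import Data.List.Membership.Propositional using (_∈_; _∉_)
open import Data.List.Membership.Propositional.Properties using (∈-allFin; ∈-map⁺; ∈-++⁺ˡ; ∈-++⁺ʳ)
open import Data.List.Membership.Propositional.Properties.WithK using (unique∧set⇒bag)
open import Data.List.Properties using (filter-++; length-++)
open import Data.List.Relation.Binary.BagAndSetEquality using (∼bag⇒↭)
open import Data.List.Relation.Binary.Permutation.Propositional using (_↭_; ↭⇒↭ₛ)
import Data.List.Relation.Binary.Permutation.Propositional.Properties as Perm
open import Data.List.Relation.Binary.Permutation.Setoid.Properties using (Unique-resp-↭)
open import Data.List.Relation.Unary.All as All using (All; []; _∷_)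
open import Data.List.Relation.Unary.All.Properties using (all⁺; ∷ʳ⁺)
open import Data.List.Relation.Unary.AllPairs using ([]; _∷_)
open import Data.List.Relation.Unary.Any using (here; there)
open import Data.List.Relation.Unary.Unique.Propositional using (Unique)
open import Data.List.Relation.Unary.Unique.Propositional.Properties using (map⁺; allFin⁺)
open import Data.Nat using (ℕ; zero; suc; _+_; _*_; _∸_; _≤_; _<_; _<ᵇ_; z≤n; s≤s; _<?_)
open import Data.Nat.DivMod using (_mod_)
open import Data.Nat.ListAction using (sum)
open import Data.Nat.ListAction.Properties using (sum-↭)
open import Data.Nat.Properties using (+-comm; +-assoc; +-suc; +-identityʳ; +-monoʳ-≤; m≤m+n; ≤-trans; ≤-refl; ≤-reflexive; ≤-antisym; ≮⇒≥; <-asym; <ᵇ⇒<; <⇒<ᵇ; m+[n∸m]≡n)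
open import Data.Nat.Solver using (module +-*-Solver)
open import Data.Product using (_×_; _,_; ∃; ∃₂; proj₂)
open import Data.Sum using (_⊎_; inj₁; inj₂)
open import Data.Unit using (tt)
open import Data.Vec using (Vec; []; _∷_; lookup; toList; _[_]≔_)
open import Data.Vec.Properties using (lookup∘update; lookup∘update′; lookup-replicate)
open import Function using (_∘_; id; mk⇔; Equivalence)
open import Relation.Binary.PropositionalEquality using (_≡_; _≢_; refl; sym; trans; cong; cong₂; subst; setoid; module ≡-Reasoning)
open import Relation.Nullary using (¬_; yes; no; does; _×-dec_; _⊎-dec_)
open import Relation.Nullary.Decidable using (dec-true; dec-false; toWitness)

private
  variable
    A B : Set
    n i : ℕ

-- Sums over lists

ι : Bool → ℕ
ι b = if b then 1 else 0

∑ : List A → (A → ℕ) → ℕ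
∑ xs f = sum (map f xs)

∑-cong : ∀ (xs : List A) {f g} → (∀ {x} → x ∈ xs → f x ≡ g x) → ∑ xs f ≡ ∑ xs g
∑-cong []       eq = refl
∑-cong (x ∷ xs) eq = cong₂ _+_ (eq (here refl)) (∑-cong xs (eq ∘ there))

∑-zero : ∀ (xs : List A) {f} → (∀ {x} → x ∈ xs → f x ≡ 0) → ∑ xs f ≡ 0
∑-zero []       eq = refl
∑-zero (x ∷ xs) eq = cong₂ _+_ (eq (here refl)) (∑-zero xs (eq ∘ there))

∑-+ : ∀ (xs : List A) f g → ∑ xs (λ x → f x + g x) ≡ ∑ xs f + ∑ xs g
∑-+ []       f g = refl
∑-+ (x ∷ xs) f g = trans (cong (f x + g x +_) (∑-+ xs f g))
  (solve 4 (λ a b c d → (a :+ b) :+ (c :+ d) := (a :+ c) :+ (b :+ d)) refl (f x) (g x) (∑ xs f) (∑ xs g))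
  where open +-*-Solver

∑-only : ∀ {xs : List A} {u f} → Unique xs → u ∈ xs →
         (∀ {w} → w ∈ xs → w ≢ u → f w ≡ 0) → ∑ xs f ≡ f u
∑-only {xs = x ∷ xs} {f = f} (x∉ ∷ _) (here refl) z =
  trans (cong (f x +_) (∑-zero xs λ w∈ → z (there w∈) λ { refl → All.lookup x∉ w∈ refl })) (+-identityʳ _)
∑-only (x∉ ∷ !xs) (there u∈) z =
  cong₂ _+_ (z (here refl) (All.lookup x∉ u∈)) (∑-only !xs u∈ (z ∘ there))

∑-↭ : ∀ {xs ys : List A} f → xs ↭ ys → ∑ xs f ≡ ∑ ys f
∑-↭ f p = sum-↭ (Perm.map⁺ f p)

countᵇ-filterᵇ : ∀ (p r : A → Bool) xs → countᵇ p (filterᵇ r xs) ≡ ∑ xs (λ x → ι (r x ∧ p x))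
countᵇ-filterᵇ p r []       = refl
countᵇ-filterᵇ p r (x ∷ xs) with r x
... | false = countᵇ-filterᵇ p r xs
... | true  with p x
...   | false = countᵇ-filterᵇ p r xs
...   | true  = cong suc (countᵇ-filterᵇ p r xs)

countᵇ-∑ : ∀ (p : A → Bool) xs → countᵇ p xs ≡ ∑ xs (ι ∘ p)
countᵇ-∑ p []       = refl
countᵇ-∑ p (x ∷ xs) with p x
... | false = countᵇ-∑ p xs
... | true  = cong suc (countᵇ-∑ p xs)

countᵇ-map : ∀ (p : B → Bool) (h : A → B) xs → countᵇ p (map h xs) ≡ countᵇ (p ∘ h) xs
countᵇ-map p h []       = refl
countᵇ-map p h (x ∷ xs) with p (h x)
... | false = countᵇ-map p h xs
... | true  = cong suc (countᵇ-map p h xs)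

countᵇ-concatMap : ∀ (p : B → Bool) (h : A → List B) xs →
                   countᵇ p (concatMap h xs) ≡ ∑ xs (λ x → countᵇ p (h x))
countᵇ-concatMap p h []       = refl
countᵇ-concatMap p h (x ∷ xs) =
  trans (cong length (filter-++ (Bool.T? ∘ p) (h x) (concatMap h xs)))
    (trans (length-++ (filterᵇ p (h x))) (cong (countᵇ p (h x) +_) (countᵇ-concatMap p h xs)))

-- Label and weight counts on a set of vertices

Z₇ : Set
Z₇ = Fin 7

δ : Z₇ → Z₇ → ℕ
δ x a = ι (does (x ≟ a))

labelCount : (Fin n → Z₇) → List (Fin n) → Z₇ → ℕ
labelCount f S a = ∑ S λ u → δ (f u) a

-- The order test mirrors `edges`, which lists an edge with its smaller end first, so for a
-- duplicate-free `S` the double sum in `weightCount` meets each edge inside `S` once.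
edgeTerm : Graph n → (Fin n → Z₇) → Z₇ → Fin n → Fin n → ℕ
edgeTerm G f a u v = ι (((toℕ u <ᵇ toℕ v) ∧ adj G u v) ∧ does (f u +ₖ f v ≟ a))

weightCount : Graph n → (Fin n → Z₇) → List (Fin n) → Z₇ → ℕ
weightCount G f S a = ∑ S λ u → ∑ S λ v → edgeTerm G f a u v

vcount≡labelCount : ∀ (f : Fin n → Z₇) a → vcount f a ≡ labelCount f (allFin n) a
vcount≡labelCount f a = countᵇ-∑ (λ u → does (f u ≟ a)) (allFin _)

ecount≡weightCount : ∀ (G : Graph n) f a → ecount G f a ≡ weightCount G f (allFin n) a
ecount≡weightCount {n} G f a =
  trans (countᵇ-concatMap weighs (λ u → map (u ,_) (filterᵇ (edge u) (allFin n))) (allFin n))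
    (∑-cong (allFin n) λ {u} _ → trans (countᵇ-map weighs (u ,_) (filterᵇ (edge u) (allFin n)))
                                       (countᵇ-filterᵇ (λ v → weighs (u , v)) (edge u) (allFin n)))
  where
  weighs : Fin n × Fin n → Bool
  weighs (u , v) = does (f u +ₖ f v ≟ a)
  edge : Fin n → Fin n → Bool
  edge u v = (toℕ u <ᵇ toℕ v) ∧ adj G u v

labelCount-↭ : ∀ (f : Fin n → Z₇) {S S′} a → S ↭ S′ → labelCount f S a ≡ labelCount f S′ a
labelCount-↭ f a p = ∑-↭ _ p

weightCount-↭ : ∀ (G : Graph n) f {S S′} a → S ↭ S′ → weightCount G f S a ≡ weightCount G f S′ a
weightCount-↭ G f {S} a p = trans (∑-cong S λ _ → ∑-↭ _ p) (∑-↭ _ p)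

-- Adding a leaf

record Attach (G : Graph n) (S : List (Fin n)) (v u : Fin n) : Set where
  field
    unique : Unique S
    fresh  : v ∉ S
    parent : u ∈ S
    joined : Adj G v u
    only   : ∀ {w} → w ∈ S → Adj G v w → w ≡ u
open Attach

+ₖ-comm : ∀ (x y : Z₇) → x +ₖ y ≡ y +ₖ x
+ₖ-comm x y = cong (_mod 7) (+-comm (toℕ x) (toℕ y))

n≮ᵇn : ∀ m → (m <ᵇ m) ≡ false
n≮ᵇn zero    = refl
n≮ᵇn (suc m) = n≮ᵇn m

edgeTerm-self : ∀ (G : Graph n) f a u → edgeTerm G f a u u ≡ 0
edgeTerm-self G f a u rewrite n≮ᵇn (toℕ u) = refl

-- Exactly one of the two orders is strict, so one summand vanishes; symmetry of `adj` and `+ₖ`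
-- makes it irrelevant which.
edgeTerm-pair : ∀ (G : Graph n) f a {v w} → v ≢ w →
  edgeTerm G f a v w + edgeTerm G f a w v ≡ ι (adj G v w ∧ does (f v +ₖ f w ≟ a))
edgeTerm-pair G f a {v} {w} v≢w with toℕ v <ᵇ toℕ w in v<w | toℕ w <ᵇ toℕ v in w<v
... | true  | true  = ⊥-elim (<-asym (<ᵇ⇒< (toℕ v) (toℕ w) (subst T (sym v<w) tt))
                                     (<ᵇ⇒< (toℕ w) (toℕ v) (subst T (sym w<v) tt)))
... | true  | false = +-identityʳ _
... | false | true  rewrite adj-sym G w v | +ₖ-comm (f w) (f v) = refl
... | false | false = ⊥-elim (v≢w (toℕ-injective (≤-antisym
                        (≮⇒≥ λ lt → subst T w<v (<⇒<ᵇ lt)) (≮⇒≥ λ lt → subst T v<w (<⇒<ᵇ lt)))))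

-- The double sum splits into the diagonal term at `v`, which is zero, the row and column of `v`,
-- which pair up, and the old block. Among the pairs only the one with the parent survives.
weightCount-attach : ∀ {G : Graph n} {S v u} → Attach G S v u → ∀ f a →
  weightCount G f (v ∷ S) a ≡ δ (f v +ₖ f u) a + weightCount G f S a
weightCount-attach {G = G} {S} {v} {u} att f a = begin
  (h v v + ∑ S (h v)) + ∑ S (λ w → h w v + ∑ S (h w))
    ≡⟨ cong₂ (λ x y → (x + ∑ S (h v)) + y) (edgeTerm-self G f a v) (∑-+ S (λ w → h w v) _) ⟩
  ∑ S (h v) + (∑ S (λ w → h w v) + weightCount G f S a)
    ≡⟨ +-assoc (∑ S (h v)) _ _ ⟨
  (∑ S (h v) + ∑ S (λ w → h w v)) + weightCount G f S a
    ≡⟨ cong (_+ weightCount G f S a) (∑-+ S (h v) _) ⟨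
  ∑ S (λ w → h v w + h w v) + weightCount G f S a
    ≡⟨ cong (_+ weightCount G f S a) (∑-cong S λ w∈ → edgeTerm-pair G f a λ { refl → fresh att w∈ }) ⟩
  ∑ S (λ w → ι (adj G v w ∧ does (f v +ₖ f w ≟ a))) + weightCount G f S a
    ≡⟨ cong (_+ weightCount G f S a) (∑-only (unique att) (parent att) nonadj) ⟩
  ι (adj G v u ∧ does (f v +ₖ f u ≟ a)) + weightCount G f S a
    ≡⟨ cong (λ b → ι (b ∧ does (f v +ₖ f u ≟ a)) + weightCount G f S a) (joined att) ⟩
  δ (f v +ₖ f u) a + weightCount G f S a ∎
  where
  open ≡-Reasoning
  h = edgeTerm G f a
  nonadj : ∀ {w} → w ∈ S → w ≢ u → ι (adj G v w ∧ does (f v +ₖ f w ≟ a)) ≡ 0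
  nonadj {w} w∈ w≢u with adj G v w in eq
  ... | true  = ⊥-elim (w≢u (only att w∈ eq))
  ... | false = refl

_[_↦_] : (Fin n → A) → Fin n → A → Fin n → A
(f [ v ↦ x ]) u = if does (u ≟ v) then x else f u

↦-same : ∀ (f : Fin n → A) v x → (f [ v ↦ x ]) v ≡ x
↦-same f v x rewrite dec-true (v ≟ v) refl = refl

↦-other : ∀ (f : Fin n → A) {v u} x → u ≢ v → (f [ v ↦ x ]) u ≡ f u
↦-other f {v} {u} x u≢v rewrite dec-false (u ≟ v) u≢v = refl

↦-fresh : ∀ (f : Fin n → A) {S v u} x → v ∉ S → u ∈ S → (f [ v ↦ x ]) u ≡ f u
↦-fresh f x v∉ u∈ = ↦-other f x λ { refl → v∉ u∈ }

labelCount-extend : ∀ (f : Fin n → Z₇) {S v} x a → v ∉ S →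
  labelCount (f [ v ↦ x ]) (v ∷ S) a ≡ δ x a + labelCount f S a
labelCount-extend f {S} {v} x a v∉ =
  cong₂ _+_ (cong (λ y → δ y a) (↦-same f v x))
            (∑-cong S λ u∈ → cong (λ y → δ y a) (↦-fresh f x v∉ u∈))

weightCount-extend : ∀ {G : Graph n} {S v u} → Attach G S v u → ∀ f x a →
  weightCount G (f [ v ↦ x ]) (v ∷ S) a ≡ δ (x +ₖ f u) a + weightCount G f S a
weightCount-extend {G = G} {S} {v} {u} att f x a =
  trans (weightCount-attach att (f [ v ↦ x ]) a)
    (cong₂ _+_ (cong₂ (λ y z → δ (y +ₖ z) a) (↦-same f v x) (old (parent att)))
               (∑-cong S λ u∈ → ∑-cong S λ {w} w∈ →
                 cong₂ (λ y z → ι (_ ∧ does (y +ₖ z ≟ a))) (old u∈) (old w∈)))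
  where
  old : ∀ {w} → w ∈ S → (f [ v ↦ x ]) w ≡ f w
  old = ↦-fresh f x (fresh att)

-- Balanced counts: the subset records which values occur once more than the others

Counts : ℕ → Subset 7 → (Z₇ → ℕ) → Set
Counts q p c = ∀ a → c a ≡ q + ι (lookup p a)

ι-insert : ∀ {p : Subset 7} {x} → lookup p x ≡ false → ∀ a →
           ι (lookup (p [ x ]≔ true) a) ≡ δ x a + ι (lookup p a)
ι-insert {p} {x} x∉ a with x ≟ a
... | yes refl rewrite x∉ | lookup∘update x p true = refl
... | no  x≢a  = cong ι (lookup∘update′ (x≢a ∘ sym) p true)

Counts-insert : ∀ {c c′} q p x → lookup p x ≡ false → (∀ a → c′ a ≡ δ x a + c a) →
                Counts q p c → Counts q (p [ x ]≔ true) c′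
Counts-insert {c} {c′} q p x x∉ eq cnt a = begin
  c′ a                              ≡⟨ eq a ⟩
  δ x a + c a                       ≡⟨ cong (δ x a +_) (cnt a) ⟩
  δ x a + (q + ι (lookup p a))      ≡⟨ solve 3 (λ d q l → d :+ (q :+ l) := q :+ (d :+ l)) refl (δ x a) q _ ⟩
  q + (δ x a + ι (lookup p a))      ≡⟨ cong (q +_) (ι-insert {p} x∉ a) ⟨
  q + ι (lookup (p [ x ]≔ true) a)  ∎
  where open ≡-Reasoning; open +-*-Solver

Counts-carry : ∀ {q c} → Counts q ⊤ c → Counts (suc q) ⊥ c
Counts-carry {q} cnt a rewrite cnt a | lookup-replicate a true | lookup-replicate a false = +-suc q 0

Counts-near : ∀ {q p c} → Counts q p c → ∀ a b → Near (c a) (c b)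
Counts-near {q} {p} {c} cnt a b = bound a b , bound b a
  where
  ι≤1 : ∀ x → ι x ≤ 1
  ι≤1 true  = ≤-refl
  ι≤1 false = z≤n
  bound : ∀ a b → c a ≤ suc (c b)
  bound a b rewrite cnt a | cnt b =
    ≤-trans (+-monoʳ-≤ q (ι≤1 (lookup p a))) (≤-trans (≤-reflexive (+-comm q 1)) (s≤s (m≤m+n q _)))

∣insert∣ : ∀ (p : Subset n) {x} → lookup p x ≡ false → ∣ p [ x ]≔ true ∣ ≡ suc ∣ p ∣
∣insert∣ (false ∷ p) {zero}  refl = refl
∣insert∣ (true  ∷ p) {suc x} x∉   = cong suc (∣insert∣ p x∉)
∣insert∣ (false ∷ p) {suc x} x∉   = ∣insert∣ p x∉

∣p∣<n⇒∃∉ : ∀ (p : Subset n) → ∣ p ∣ < n → ∃ λ x → lookup p x ≡ false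
∣p∣<n⇒∃∉ (false ∷ p) lt       = zero , refl
∣p∣<n⇒∃∉ (true  ∷ p) (s≤s lt) = let x , x∉ = ∣p∣<n⇒∃∉ p lt in suc x , x∉

record Balanced (G : Graph n) (q : ℕ) (L W : Subset 7) (S : List (Fin n)) (f : Fin n → Z₇) : Set where
  constructor balanced
  field
    labels  : Counts q L (labelCount f S)
    weights : Counts q W (weightCount G f S)

⟨_⟩ : Z₇ → Subset 7
⟨ a ⟩ = ⊥ [ a ]≔ true

ι⟨⟩ : ∀ x a → ι (lookup ⟨ x ⟩ a) ≡ δ x a
ι⟨⟩ x a = trans (ι-insert {⊥} {x} (lookup-replicate x false) a)
  (trans (cong (λ b → δ x a + ι b) (lookup-replicate a false)) (+-identityʳ _))

Balanced-extend : ∀ {G : Graph n} {q L W S f v u} x → Attach G S v u →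
  lookup L x ≡ false → lookup W (x +ₖ f u) ≡ false → Balanced G q L W S f →
  Balanced G q (L [ x ]≔ true) (W [ x +ₖ f u ]≔ true) (v ∷ S) (f [ v ↦ x ])
Balanced-extend {q = q} {L} {W} {f = f} {u = u} x att x∉ w∉ (balanced lab wt) = balanced
  (Counts-insert q L x x∉ (λ a → labelCount-extend f x a (fresh att)) lab)
  (Counts-insert q W (x +ₖ f u) w∉ (weightCount-extend att f x) wt)

abstract
  +ₖ-solve : ∀ (w y : Z₇) → ∃ λ x → x +ₖ y ≡ w
  +ₖ-solve = toWitness {a? = all? λ w → all? λ y → any? λ x → x +ₖ y ≟ w} tt

-- With all labels equally frequent, the new vertex may take any label, so its label can be solved
-- from the one missing weight. That label becomes the surplus of the next block.
Balanced-seventh : ∀ {G : Graph n} {q L W S f v u} → Attach G S v u →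
  Balanced G q L W S f → ∣ L ∣ ≡ 7 → ∣ W ∣ ≡ 6 →
  ∃₂ λ g a → Balanced G (suc q) ⟨ a ⟩ ⊥ (v ∷ S) g
Balanced-seventh {G = G} {q} {L} {W} {S} {f} {v} {u} att (balanced lab wt) ∣L∣ ∣W∣
  with refl ← ∣p∣≡n⇒p≡⊤ {p = L} ∣L∣
  with w , w∉ ← ∣p∣<n⇒∃∉ W (≤-reflexive (cong suc ∣W∣))
  with x , refl ← +ₖ-solve w (f u) =
  g , x , balanced
    (Counts-insert (suc q) ⊥ x (lookup-replicate x false) (λ a → labelCount-extend f x a (fresh att))
      (Counts-carry lab))
    (Counts-carry (subst (λ p → Counts q p (weightCount G g (v ∷ S))) full
      (Counts-insert q W (x +ₖ f u) w∉ (weightCount-extend att f x) wt)))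
  where
  g = f [ v ↦ x ]
  full : W [ x +ₖ f u ]≔ true ≡ ⊤
  full = ∣p∣≡n⇒p≡⊤ (trans (∣insert∣ W w∉) (cong suc ∣W∣))

-- Affine changes of labels

-- The factor `suc (toℕ c)` runs through the units of `Z₇`, so each of these maps is a bijection.
affine : Fin 6 → Z₇ → Z₇ → Z₇
affine c d x = (suc (toℕ c) * toℕ (x +ₖ d)) mod 7

abstract
  -- Here `b` is the preimage of `a`; the Boolean form lets counts of `a` be rewritten termwise as
  -- counts of `b`.
  affine-label : ∀ c d a → ∃ λ b → ∀ x → does (affine c d x ≟ a) ≡ does (x ≟ b)
  affine-label = toWitness {a? = all? λ c → all? λ d → all? λ a → any? λ b → all? λ x →
    does (affine c d x ≟ a) Bool.≟ does (x ≟ b)} tt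

  -- Each end contributes the shift `d`, so weights undergo a bijection with the same factor and the
  -- doubled shift.
  affine-+ₖ : ∀ c d x y → affine c d x +ₖ affine c d y ≡ affine c (d +ₖ d) (x +ₖ y)
  affine-+ₖ = toWitness {a? = all? λ c → all? λ d → all? λ x → all? λ y →
    affine c d x +ₖ affine c d y ≟ affine c (d +ₖ d) (x +ₖ y)} tt

  -- Shift by the negative of `a`; if `p` differs from `a`, scale by the inverse of their
  -- difference.
  affine-choice : ∀ a p → ∃₂ λ c d → affine c d a ≡ 0F × (affine c d p ≡ 0F ⊎ affine c d p ≡ 1F)
  affine-choice = toWitness {a? = all? λ a → all? λ p → any? λ c → any? λ d →
    (affine c d a ≟ 0F) ×-dec ((affine c d p ≟ 0F) ⊎-dec (affine c d p ≟ 1F))} tt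

Balanced-normalise : ∀ {G : Graph n} {q a S f} u → Balanced G q ⟨ a ⟩ ⊥ S f →
  ∃ λ g → Balanced G q ⟨ 0F ⟩ ⊥ S g × (g u ≡ 0F ⊎ g u ≡ 1F)
Balanced-normalise {G = G} {q} {a₀} {S} {f} u (balanced lab wt)
  with c , d , φa₀≡0 , φu ← affine-choice a₀ (f u) = φ ∘ f , balanced lab′ wt′ , φu
  where
  open ≡-Reasoning
  φ = affine c d
  lab′ : Counts q ⟨ 0F ⟩ (labelCount (φ ∘ f) S)
  lab′ a with b , eq ← affine-label c d a = begin
    labelCount (φ ∘ f) S a    ≡⟨ ∑-cong S (λ {w} _ → cong ι (eq (f w))) ⟩
    labelCount f S b          ≡⟨ lab b ⟩
    q + ι (lookup ⟨ a₀ ⟩ b)   ≡⟨ cong (q +_) (ι⟨⟩ a₀ b) ⟩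
    q + δ a₀ b                ≡⟨ cong (λ t → q + ι t) (eq a₀) ⟨
    q + δ (φ a₀) a            ≡⟨ cong (λ t → q + δ t a) φa₀≡0 ⟩
    q + δ 0F a                ≡⟨ cong (q +_) (ι⟨⟩ 0F a) ⟨
    q + ι (lookup ⟨ 0F ⟩ a)   ∎
  wt′ : Counts q ⊥ (weightCount G (φ ∘ f) S)
  wt′ a with b , eq ← affine-label c (d +ₖ d) a = begin
    weightCount G (φ ∘ f) S a
      ≡⟨ ∑-cong S (λ {v} _ → ∑-cong S λ {w} _ → cong (λ t → ι (((toℕ v <ᵇ toℕ w) ∧ adj G v w) ∧ t))
          (trans (cong (λ z → does (z ≟ a)) (affine-+ₖ c d (f v) (f w))) (eq (f v +ₖ f w)))) ⟩
    weightCount G f S b       ≡⟨ wt b ⟩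
    q + ι (lookup ⊥ b)        ≡⟨ cong (λ t → q + ι t) (lookup-replicate b false) ⟩
    q + 0                     ≡⟨ cong (λ t → q + ι t) (lookup-replicate a false) ⟨
    q + ι (lookup ⊥ a)        ∎

-- The finite search

-- The parent of an added vertex: an old vertex of the given label, or the vertex added at
-- the given position, the most recent one having position 0.
data Parent (i : ℕ) : Set where
  old   : Z₇ → Parent i
  added : Fin i → Parent i

parentLabel : Parent i → Vec Z₇ i → Z₇
parentLabel (old a)   xs = a
parentLabel (added j) xs = lookup xs j

-- Labels of the added vertices (most recent first), the labels still available, the weights
-- used up.
data Partial (i : ℕ) : Set where
  partial : Vec Z₇ i → List Z₇ → Subset 7 → Partial i

-- Labels passed over collect in `tried`, so that `tried ++ rest` is what remains available once `x`
-- is taken.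
tryAll : Z₇ → Vec Z₇ i → Subset 7 → List Z₇ → List Z₇ → List (Partial (suc i)) → List (Partial (suc i))
tryAll y xs W tried []         r = r
tryAll y xs W tried (x ∷ rest) r =
  if lookup W (x +ₖ y) then next else partial (x ∷ xs) (tried ++ rest) (W [ x +ₖ y ]≔ true) ∷ next
  where next = tryAll y xs W (x ∷ tried) rest r

extensions : Parent i → List (Partial i) → List (Partial (suc i))
extensions c []                    = []
extensions c (partial xs R W ∷ ps) = tryAll (parentLabel c xs) xs W [] R (extensions c ps)

parents : ∀ i → List (Parent i)
parents i = map old (allFin 7) ++ map added (allFin i)

∈-parents : ∀ (c : Parent i) → c ∈ parents i
∈-parents (old a)   = ∈-++⁺ˡ (∈-map⁺ old (∈-allFin a))
∈-parents (added j) = ∈-++⁺ʳ (map old (allFin 7)) (∈-map⁺ added (∈-allFin j))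

-- All surviving labellings are carried along while the parents are quantified, so a labelling need
-- only be chosen once all parents are known.
extendable : ℕ → List (Partial i) → Bool
extendable zero    []      = false
extendable zero    (_ ∷ _) = true
extendable (suc k) ps      = all (λ c → extendable k (extensions c ps)) (parents _)

-- Label 0 is withheld because it is the surplus label after normalisation.
initial : List (Partial 0)
initial = partial [] (map suc (allFin 6)) ⊥ ∷ []

-- A data type, so that the conversion checker compares k and ps and does not run the search.
data Extendable (k : ℕ) (ps : List (Partial i)) : Set where
  verified : extendable k ps ≡ true → Extendable k ps

abstract
  -- The first parent is necessarily old, with label 0 or 1. The next five have 8, 9, 10, 11 and 12
  -- possibilities, all run through by evaluation.
  search : ∀ {y} → y ≡ 0F ⊎ y ≡ 1F → Extendable 5 (extensions (old y) initial)
  search (inj₁ refl) = verified refl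
  search (inj₂ refl) = verified refl

Extendable-step : ∀ {k} {ps : List (Partial i)} → Extendable (suc k) ps →
                  ∀ c → Extendable k (extensions c ps)
Extendable-step {k = k} {ps} (verified ok) c = verified (Equivalence.to Bool.T-≡
  (All.lookup (all⁺ (λ c → extendable k (extensions c ps)) (parents _) (Equivalence.from Bool.T-≡ ok)) (∈-parents c)))

¬Extendable-[] : ∀ {i} k → ¬ Extendable {i} k []
¬Extendable-[] zero    (verified ())
¬Extendable-[] (suc k) ok = ¬Extendable-[] k (Extendable-step ok (old 0F))

-- An empty list of labellings stays empty under extension, so survivors exist at every intermediate
-- stage. This covers blocks of fewer than six vertices.
Extendable-head : ∀ {k} {ps : List (Partial i)} → Extendable k ps → ∃ λ p → p ∈ ps
Extendable-head {ps = p ∷ ps} ok = p , here refl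
Extendable-head {k = k} {[]}  ok = ⊥-elim (¬Extendable-[] k ok)

-- Labelling up to six added vertices

assign : (Fin n → Z₇) → Vec (Fin n) i → Vec Z₇ i → Fin n → Z₇
assign f []       []       = f
assign f (v ∷ vs) (x ∷ xs) = assign f vs xs [ v ↦ x ]

raise : Parent i → Parent (suc i)
raise (old a)   = old a
raise (added j) = added (suc j)

-- An old vertex matters only through its label, since this alone determines the weights of new
-- edges to it.
parentOf : (Fin n → Z₇) → Vec (Fin n) i → Fin n → Parent i
parentOf f []       u = old (f u)
parentOf f (v ∷ vs) u = if does (u ≟ v) then added zero else raise (parentOf f vs u)

parentLabel-parentOf : ∀ (f : Fin n → Z₇) (vs : Vec (Fin n) i) xs u →
                       parentLabel (parentOf f vs u) xs ≡ assign f vs xs u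
parentLabel-parentOf f []       []       u = refl
parentLabel-parentOf f (v ∷ vs) (x ∷ xs) u with does (u ≟ v)
... | true  = refl
... | false = trans (lift (parentOf f vs u)) (parentLabel-parentOf f vs xs u)
  where
  lift : ∀ c → parentLabel (raise c) (x ∷ xs) ≡ parentLabel c xs
  lift (old a)   = refl
  lift (added j) = refl

data Chain (G : Graph n) (S₀ : List (Fin n)) : Vec (Fin n) i → Set where
  []  : Chain G S₀ []
  _∷_ : ∀ {v u} {vs : Vec (Fin n) i} → Attach G (toList vs ++ S₀) v u → Chain G S₀ vs → Chain G S₀ (v ∷ vs)

Available : Subset 7 → List Z₇ → Set
Available L R = Unique R × All (λ x → lookup L x ≡ false) R

Available-↭ : ∀ {L R R′} → R ↭ R′ → Available L R → Available L R′
Available-↭ p (!R , R∉) = Unique-resp-↭ (setoid Z₇) (↭⇒↭ₛ p) !R , Perm.All-resp-↭ p R∉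

Available-take : ∀ {L x R} → Available L (x ∷ R) → lookup L x ≡ false × Available (L [ x ]≔ true) R
Available-take {L} {x} (x≢ ∷ !R , x∉ ∷ R∉) = x∉ , !R ,
  All.zipWith (λ (x≢y , y∉) → trans (lookup∘update′ (x≢y ∘ sym) L true) y∉) (x≢ , R∉)

module _ {n} (G : Graph n) (q : ℕ) (S₀ : List (Fin n)) where

  Valid : (Fin n → Z₇) → Vec (Fin n) i → Partial i → Set
  Valid {i} f vs (partial xs R W) = ∃ λ L →
    Balanced G q L W (toList vs ++ S₀) (assign f vs xs) × ∣ L ∣ ≡ suc i × ∣ W ∣ ≡ i × Available L R

  tryAll-valid : ∀ {f} {vs : Vec (Fin n) i} {v u xs W} → Attach G (toList vs ++ S₀) v u →
    ∀ tried rest {r} → Valid f vs (partial xs (tried ++ rest) W) → All (Valid f (v ∷ vs)) r →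
    All (Valid f (v ∷ vs)) (tryAll (assign f vs xs u) xs W tried rest r)
  tryAll-valid att tried [] _ valid = valid
  tryAll-valid {f = f} {vs} {u = u} {xs} {W} att tried (x ∷ rest) (L , bal , ∣L∣ , ∣W∣ , avail) valid
    -- Moving `x` to the front serves both outcomes: it is either taken from there or passed over
    -- into `tried`.
    with avail′ ← Available-↭ {L} (Perm.shift x tried rest) avail
    with lookup W (x +ₖ assign f vs xs u) in w∉
  ... | true  = tryAll-valid att (x ∷ tried) rest (L , bal , ∣L∣ , ∣W∣ , avail′) valid
  ... | false with x∉ , avail″ ← Available-take {L} avail′ =
    (L [ x ]≔ true , Balanced-extend x att x∉ w∉ bal ,
     trans (∣insert∣ L x∉) (cong suc ∣L∣) , trans (∣insert∣ W w∉) (cong suc ∣W∣) , avail″)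
    ∷ tryAll-valid att (x ∷ tried) rest (L , bal , ∣L∣ , ∣W∣ , avail′) valid

  extensions-valid : ∀ {f} {vs : Vec (Fin n) i} {v u} → Attach G (toList vs ++ S₀) v u →
    ∀ {ps} → All (Valid f vs) ps → All (Valid f (v ∷ vs)) (extensions (parentOf f vs u) ps)
  extensions-valid att [] = []
  extensions-valid {f = f} {vs} {u = u} att {partial xs R W ∷ _} (p ∷ ps)
    rewrite parentLabel-parentOf f vs xs u = tryAll-valid att [] R p (extensions-valid att ps)

  initial-valid : ∀ {f} → Balanced G q ⟨ 0F ⟩ ⊥ S₀ f → All (Valid f []) initial
  initial-valid bal = (⟨ 0F ⟩ , bal , refl , refl ,
    map⁺ suc-injective (allFin⁺ 6) , refl ∷ refl ∷ refl ∷ refl ∷ refl ∷ refl ∷ []) ∷ []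

  candidates : ∀ {a f} {vs : Vec (Fin n) (suc i)} k → i + k ≡ 5 → Balanced G q ⟨ a ⟩ ⊥ S₀ f →
    Chain G S₀ vs → ∃₂ λ g ps → Extendable k ps × All (Valid g vs) ps
  candidates k refl bal (_∷_ {u = u} att [])
    with g , bal′ , gu ← Balanced-normalise u bal =
    g , extensions (old (g u)) initial , search gu , extensions-valid att (initial-valid bal′)
  candidates {suc i} k eq bal (_∷_ {u = u} {vs} att ch@(_ ∷ _))
    with g , ps , ok , valid ← candidates (suc k) (trans (+-suc i k) eq) bal ch =
    g , extensions (parentOf g vs u) ps , Extendable-step ok _ , extensions-valid att valid

  label-chain : ∀ {a f} {vs : Vec (Fin n) i} → i ≤ 6 → Balanced G q ⟨ a ⟩ ⊥ S₀ f → Chain G S₀ vs →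
    ∃ λ g → ∃₂ λ L W → Balanced G q L W (toList vs ++ S₀) g × ∣ L ∣ ≡ suc i × ∣ W ∣ ≡ i
  -- No parent is there to normalise by, and the given labelling already serves.
  label-chain {a = a} {f} i≤6 bal [] =
    f , ⟨ a ⟩ , ⊥ , bal , ∣insert∣ (⊥ {7}) {a} (lookup-replicate a false) , refl
  label-chain {suc i} (s≤s i≤5) bal ch@(_ ∷ _)
    with g , ps , ok , valid ← candidates (5 ∸ i) (m+[n∸m]≡n i≤5) bal ch
    with partial xs R W , p∈ ← Extendable-head ok
    with L , bal′ , ∣L∣ , ∣W∣ , _ ← All.lookup valid p∈ = _ , L , W , bal′ , ∣L∣ , ∣W∣

-- Growing a tree

-- The labels of `vs` stay undecided until the block is complete or the tree ends, as they depend on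
-- the parents of the whole block.
data Stage (G : Graph n) : List (Fin n) → Set where
  stage : ∀ {S₀ q a f} {vs : Vec (Fin n) i} → i ≤ 6 →
          Balanced G q ⟨ a ⟩ ⊥ S₀ f → Chain G S₀ vs → Stage G (toList vs ++ S₀)

stage-attach : ∀ {G : Graph n} {S v u} → Stage G S → Attach G S v u → Stage G (v ∷ S)
stage-attach {G = G} (stage {i = i} {S₀} {q} i≤6 bal ch) att with i <? 6
... | yes i<6 = stage i<6 bal (att ∷ ch)
-- Six vertices are pending and a seventh arrives: the block is labelled, closed, and a new one
-- starts empty.
... | no  i≮6 with refl ← ≤-antisym i≤6 (≮⇒≥ i≮6)
              with g , L , W , bal′ , ∣L∣ , ∣W∣ ← label-chain G q S₀ i≤6 bal ch
              with h , b , bal″ ← Balanced-seventh att bal′ ∣L∣ ∣W∣ = stage z≤n bal″ []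

data Grown (G : Graph n) : List (Fin n) → Set where
  root : ∀ r → Grown G (r ∷ [])
  _◁_  : ∀ {S v u} → Grown G S → Attach G S v u → Grown G (v ∷ S)

grown-unique : ∀ {G : Graph n} {S} → Grown G S → Unique S
grown-unique (root r)  = [] ∷ []
grown-unique (g ◁ att) = All.tabulate (λ { w∈ refl → fresh att w∈ }) ∷ unique att

grown-stage : ∀ {G : Graph n} {S} → Grown G S → Stage G S
grown-stage {G = G} (root r) = stage {q = 0} {0F} {λ _ → 0F} z≤n (balanced
  (Counts-insert {λ _ → 0} 0 ⊥ 0F refl (λ a → refl) (λ a → sym (cong ι (lookup-replicate a false))))
  (λ a → trans (cong (λ t → t + 0 + 0) (edgeTerm-self G (λ _ → 0F) a r)) (sym (cong ι (lookup-replicate a false))))) []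
grown-stage (g ◁ att) = stage-attach (grown-stage g) att

-- Reaching every vertex of a tree

Path : Graph n → List (Fin n) → Fin n → Fin n → Set
Path G S u w = ∃ λ vs → Walk G u w vs × Unique vs × All (_∈ S) vs

walk-∷ʳ : ∀ {G : Graph n} {u w v vs} → Walk G u w vs → Adj G w v → Walk G u v (vs ∷ʳ v)
walk-∷ʳ (stop u)     e = step e (stop _)
walk-∷ʳ (step e′ wk) e = step e′ (walk-∷ʳ wk e)

unique-∷ʳ : ∀ {vs : List A} {v} → Unique vs → v ∉ vs → Unique (vs ∷ʳ v)
unique-∷ʳ []         v∉ = [] ∷ []
unique-∷ʳ (x∉ ∷ !vs) v∉ = ∷ʳ⁺ x∉ (λ { refl → v∉ (here refl) }) ∷ unique-∷ʳ !vs (v∉ ∘ there)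

grown-path : ∀ {G : Graph n} {S} → Grown G S → ∀ {u w} → u ∈ S → w ∈ S → Path G S u w
grown-path (root r)  (here refl) (here refl) = _ , stop r , [] ∷ [] , here refl ∷ []
grown-path (g ◁ att) (here refl) (here refl) = _ , stop _ , [] ∷ [] , here refl ∷ []
grown-path (g ◁ att) (here refl) (there w∈)
  with vs , wk , !vs , vs⊆ ← grown-path g (parent att) w∈ =
  _ , step (joined att) wk , All.map (λ { x∈ refl → fresh att x∈ }) vs⊆ ∷ !vs , here refl ∷ All.map there vs⊆
grown-path {G = G} (g ◁ att) (there u∈) (here refl)
  with vs , wk , !vs , vs⊆ ← grown-path g u∈ (parent att) =
  _ , walk-∷ʳ wk (trans (adj-sym G _ _) (joined att)) ,
  unique-∷ʳ !vs (λ v∈ → fresh att (All.lookup vs⊆ v∈)) , ∷ʳ⁺ (All.map there vs⊆) (here refl)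
grown-path (g ◁ att) (there u∈) (there w∈)
  with vs , wk , !vs , vs⊆ ← grown-path g u∈ w∈ = vs , wk , !vs , All.map there vs⊆

-- A second neighbour `w` of `v` in `S` would close a cycle: a path from `u` to `w` inside `S`
-- avoids `v` and has at least two vertices.
attach : ∀ {G : Graph n} {S u v} → ¬ HasCycle G → Grown G S → u ∈ S → v ∉ S → Adj G u v → Attach G S v u
attach {G = G} {S} {u} {v} acyclic g u∈ v∉ e = record
  { unique = grown-unique g ; fresh = v∉ ; parent = u∈ ; joined = vu ; only = only′ }
  where
  vu : Adj G v u
  vu = trans (adj-sym G v u) e
  long : ∀ {x y vs} → Walk G x y vs → y ≢ x → 2 ≤ length vs
  long (stop _)            y≢x = ⊥-elim (y≢x refl)
  long (step _ (stop _))   _   = s≤s (s≤s z≤n)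
  long (step _ (step _ _)) _   = s≤s (s≤s z≤n)
  only′ : ∀ {w} → w ∈ S → Adj G v w → w ≡ u
  only′ {w} w∈ vw with w ≟ u
  ... | yes w≡u = w≡u
  ... | no  w≢u with vs , wk , !vs , vs⊆ ← grown-path g u∈ w∈ =
    ⊥-elim (acyclic (v , w , v ∷ vs , step vu wk ,
      All.map (λ { x∈ refl → v∉ x∈ }) vs⊆ ∷ !vs , s≤s (long wk w≢u) , trans (adj-sym G w v) vw))

grow-along : ∀ {G : Graph n} {S u t vs} → ¬ HasCycle G → Grown G S → u ∈ S → Walk G u t vs →
  ∃ λ S′ → Grown G S′ × (∀ {x} → x ∈ S → x ∈ S′) × t ∈ S′
grow-along acyclic g u∈ (stop _) = _ , g , id , u∈
grow-along {S = S} acyclic g u∈ (step {v = v} e wk) with _∈?_ _≟_ v S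
-- The walk may revisit the grown set; only vertices outside it are attached.
... | yes v∈ = grow-along acyclic g v∈ wk
... | no  v∉ with S′ , g′ , S⊆ , t∈ ← grow-along acyclic (g ◁ attach acyclic g u∈ v∉ e) (here refl) wk =
  S′ , g′ , S⊆ ∘ there , t∈

grow-over : ∀ {G : Graph n} {S r} → Connected G → ¬ HasCycle G → Grown G S → r ∈ S → ∀ ts →
  ∃ λ S′ → Grown G S′ × All (_∈ S′) ts × (∀ {x} → x ∈ S → x ∈ S′)
grow-over conn acyclic g r∈ [] = _ , g , [] , id
grow-over conn acyclic g r∈ (t ∷ ts)
  with S₁ , g₁ , S⊆S₁ , t∈ ← grow-along acyclic g r∈ (proj₂ (conn _ t))
  with S₂ , g₂ , ts∈ , S₁⊆S₂ ← grow-over conn acyclic g₁ (S⊆S₁ r∈) ts =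
  S₂ , g₂ , S₁⊆S₂ t∈ ∷ ts∈ , S₁⊆S₂ ∘ S⊆S₁

tree-grown : ∀ {G : Graph n} → IsTree G → ∃ λ S → Grown G S × S ↭ allFin n
tree-grown {suc n} (_ , conn , acyclic)
  with S , g , all∈ , _ ← grow-over conn acyclic (root zero) (here refl) (allFin (suc n)) =
  -- Two duplicate-free lists with the same members are permutations of each other.
  S , g , ∼bag⇒↭ (unique∧set⇒bag (grown-unique g) (allFin⁺ (suc n))
                   (mk⇔ (λ _ → ∈-allFin _) (λ _ → All.lookup all∈ (∈-allFin _))))

theorem3p1 : (n : ℕ) (T : Graph n) → IsTree T → IsCordial 7 T
theorem3p1 n T tree
  with S , g , S↭ ← tree-grown tree
  with stage {S₀ = S₀} {q} i≤6 bal ch ← grown-stage g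
  -- The last, incomplete block is labelled here; any surplus sets `L` and `W` keep the counts
  -- within one of each other.
  with f , L , W , (balanced lab wt) , _ ← label-chain T q S₀ i≤6 bal ch =
  f ,
  Counts-near {q} {L} (λ a → trans (vcount≡labelCount f a) (trans (sym (labelCount-↭ f a S↭)) (lab a))) ,
  Counts-near {q} {W} (λ a → trans (ecount≡weightCount T f a) (trans (sym (weightCount-↭ T f a S↭)) (wt a)))
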